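{- For all integers $n>0$ and $k\ge 3$, there exists a generalized de Bruijn word of length $kn$ over $\Sigma_k$ with completely unclustered Burrows--Wheeler Transform. In particular, for all integers $n>0$ and $k\geq 3$, there exists a (standard) de Bruijn word of length $k^n$ over $\Sigma_k$ with completely unclustered Burrows--Wheeler Transform.
   Context: $\Sigma_k=\{0,1,\ldots,k-1\}$ with the usual order. The shift of a word $w=w_0\cdots w_{m-1}$ is $w_{m-1}w_0\cdots w_{m-2}$. A necklace $[w]$ is an equivalence class of words under iterated shift; its length is $|w|$. The Burrows--Wheeler Transform (BWT) of a necklace $[w]$ is the word given by the last column, read top to bottom, of the matrix whose rows are the $|w|$ shifts of $w$ (counted with multiplicity) sorted in ascending lexicographic order. A necklace $u$ has a completely unclustered BWT if its BWT has exactly $|u|$ runs, i.e. no two consecutive letters of $\mathrm{BWT}(u)$ are equal (consecutive in the linear, not cyclic, sense). An alphabet-permutation is a word over $\Sigma_k$ that contains each letter of $\Sigma_k$ exactly once; an alphabet-permutation power is a concatenation of one or more (possibly different) alphabet-permutations over $\Sigma_k$. A generalized de Bruijn word of length $kn$ over $\Sigma_k$ is a necklace $u$ of length $kn$ over $\Sigma_k$ such that $\mathrm{BWT}(u)$ is an alphabet-permutation power. A (standard) de Bruijn word of order $d$ over $\Sigma_k$ is a necklace over $\Sigma_k$ containing as a circular factor each of the $k^d$ words of length $d$ over $\Sigma_k$ exactly once (so it has length $k^d$). -}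

module Defs where

open import Data.Fin.Base using (Fin; toℕ)
import Data.Fin.Properties as Fin
open import Data.List.Base
  using (List; []; _∷_; length; lookup; iterate; derun; mapMaybe; last;
         concat; initLast; _∷ʳ′_)
import Data.List.Relation.Binary.Lex.NonStrict as Lex
open import Data.List.Relation.Unary.All using (All)
import Data.List.Sort as Sort
open import Data.Nat.Base using (ℕ; _+_; _*_)
open import Data.Nat.DivMod using (_mod_)
open import Data.Product using (_×_; ∃-syntax; ∃!)
open import Data.Vec.Base as Vec using (Vec)
open import Relation.Binary.Bundles using (DecTotalOrder)
open import Relation.Binary.PropositionalEquality using (_≡_)

Word : ℕ → Set
Word k = List (Fin k)

-- w₀ ⋯ wₘ₋₁ ↦ wₘ₋₁ w₀ ⋯ wₘ₋₂
shift : ∀ {k} → Word k → Word k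
shift w with initLast w
... | []       = []
... | xs ∷ʳ′ x = x ∷ xs

-- The necklace [ w ] is the class of w under iterated shift.  There being no
-- quotient types, a necklace is given by any word representing it; BWT and
-- all the predicates on necklaces below are invariant under shift.

shifts : ∀ {k} → Word k → List (Word k)
shifts w = iterate shift w (length w)

lexicographic : ℕ → DecTotalOrder _ _ _
lexicographic k = Lex.≤-decTotalOrder (Fin.≤-decTotalOrder k)

-- The rows are the shifts of w, and there are none when w is empty, so
-- mapMaybe never discards a row.
BWT : ∀ {k} → Word k → Word k
BWT {k} w = mapMaybe last (sort (shifts w))
  where open Sort (lexicographic k)

-- derun keeps exactly one letter of each maximal block of equal letters.
runs : ∀ {k} → Word k → ℕ
runs w = length (derun Fin._≟_ w)

CompletelyUnclusteredBWT : ∀ {k} → Word k → Set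
CompletelyUnclusteredBWT u = runs (BWT u) ≡ length u

IsAlphabetPermutation : ∀ {k} → Word k → Set
IsAlphabetPermutation {k} p =
  (a : Fin k) → ∃! _≡_ λ (i : Fin (length p)) → lookup p i ≡ a

IsAlphabetPermutationPower : ∀ {k} → Word k → Set
IsAlphabetPermutationPower {k} w =
  ∃[ p ] ∃[ ps ] All (IsAlphabetPermutation {k}) (p ∷ ps) × w ≡ concat (p ∷ ps)

IsGeneralizedDeBruijn : (n : ℕ) {k : ℕ} → Word k → Set
IsGeneralizedDeBruijn n {k} u =
  length u ≡ k * n × IsAlphabetPermutationPower (BWT u)

letterAfter : ∀ {k} (w : Word k) → Fin (length w) → ℕ → Fin k
letterAfter w i j = lookup w ((toℕ i + j) mod length w)
  where instance _ = Fin.nonZeroIndex i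

OccursCircularlyAt : ∀ {k d} → Vec (Fin k) d → (w : Word k) → Fin (length w) → Set
OccursCircularlyAt {d = d} v w i =
  (j : Fin d) → letterAfter w i (toℕ j) ≡ Vec.lookup v j

IsDeBruijn : (d : ℕ) {k : ℕ} → Word k → Set
IsDeBruijn d {k} u = (v : Vec (Fin k) d) → ∃! _≡_ (OccursCircularlyAt v u)

{-# OPTIONS --safe #-}

-- Inverting the BWT, an alphabet-permutation power σ₀ ⋯ σₙ₋₁ is the BWT of a
-- necklace as soon as its standard permutation, sending the position with letter
-- a in block q to position a n + q, is a single cycle.  Choosing σ_q so that all
-- positions of block q lie in one orbit only merges orbits, so the blocks can be
-- treated one after the other; once all are done there is a single orbit, because
-- position q is the image of a position in block q and itself lies in block
-- ⌊q / k⌋.  For k ≥ 3 there is enough freedom left in the choice of σ_q to keep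
-- its first letter away from the last letter of σ_{q-1}.  When n = k^(d-1), the
-- first d letters of a row are the base-k digits of its index, whence the de
-- Bruijn property.
module Submission where

open import Defs
open import Data.Fin.Base as Fin
  using (Fin; zero; suc; toℕ; fromℕ; fromℕ<; cast; combine; remQuot; funToFin; finToFun)
import Data.Fin.Properties as Fin
open import Data.Fin.Permutation
  using (Permutation′; _⟨$⟩ʳ_; _⟨$⟩ˡ_; inverseˡ; inverseʳ; transpose; _∘ₚ_)
  renaming (id to idₚ)
import Data.Fin.Permutation.Components as PC
open import Data.Fin.Patterns using (0F; 1F; 2F)
open import Data.List.Base
  using (List; []; _∷_; _∷ʳ_; _++_; length; lookup; map; concat; mapMaybe; head; last; initLast; _∷ʳ′_;
         iterate; derun; tabulate; allFin; applyDownFrom)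
open import Data.List.Membership.Propositional using (_∈_)
open import Data.List.Membership.Propositional.Properties using (∈-allFin; ∈-tabulate⁺)
open import Data.List.Membership.Propositional.Properties.WithK using (unique∧set⇒bag)
import Data.List.Properties as List
open import Data.List.Relation.Binary.BagAndSetEquality using (∼bag⇒↭)
import Data.List.Relation.Binary.Lex.NonStrict as Lex
open import Data.List.Relation.Binary.Permutation.Propositional
  using (_↭_; ↭-trans; ↭-reflexive; ↭⇒↭ₛ′)
import Data.List.Relation.Binary.Permutation.Propositional.Properties as ↭
open import Data.List.Relation.Binary.Pointwise as Pointwise using (Pointwise-≡⇒≡)
open import Data.List.Relation.Unary.All as All using (All; []; _∷_)
import Data.List.Relation.Unary.All.Properties as All
import Data.List.Relation.Unary.AllPairs.Properties as AllPairs
open import Data.List.Relation.Unary.Linked using (Linked; []; [-]; _∷_)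
open import Data.List.Relation.Unary.Linked.Properties as Linked using (AllPairs⇒Linked)
open import Data.List.Relation.Unary.Sorted.TotalOrder using (Sorted)
open import Data.List.Relation.Unary.Sorted.TotalOrder.Properties using (↗↭↗⇒≋)
import Data.List.Relation.Unary.Unique.Propositional.Properties as Unique
open import Data.List.Sort using (sort; sort-↭; sort-↗)
open import Data.Maybe.Base using (just)
open import Data.Maybe.Relation.Binary.Connected using (Connected; just; just-nothing)
open import Data.Nat.Base
open import Data.Nat.DivMod hiding (result)
open import Data.Nat.Divisibility using (m∣m*n; n∣m*n)
open import Data.Nat.GeneralisedArithmetic using (fold; fold-+)
open import Data.Nat.Induction using (<-rec)
open import Data.Nat.Properties
open import Data.Product using (_×_; _,_; ∃!; ∃-syntax; proj₁; proj₂)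
open import Data.Sum using (_⊎_; inj₁; inj₂)
open import Data.Unit.Base using (tt)
import Data.Vec.Base as Vec
open import Data.Vec.Functional using (updateAt)
open import Data.Vec.Functional.Properties using (updateAt-updates; updateAt-minimal)
open import Function.Base using (_∘_; _$_; flip)
open import Function.Bundles using (mk⇔)
open import Function.Definitions using (Injective)
open import Relation.Binary.Bundles using (DecTotalOrder)
open import Relation.Binary.Construct.Closure.Equivalence as Eq using (EqClosure)
open import Relation.Binary.Construct.Closure.ReflexiveTransitive using (ε; _◅◅_)
open import Relation.Binary.Core using (_⇒_)
open import Relation.Binary.Definitions using (tri<; tri≈; tri>)
open import Relation.Binary.PropositionalEquality
open import Relation.Binary.Structures using (IsEquivalence)
open import Relation.Nullary using (yes; no; contradiction)
open import Relation.Nullary.Decidable using (dec-true; dec-false)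

private
  variable
    A : Set
    N n k : ℕ
    f g : Fin N → Fin N
    x y z : Fin N

-- Iterates of injective maps on a finite set.

fold-suc : ∀ {A : Set} (f : A → A) x t → fold (f x) f t ≡ f (fold x f t)
fold-suc f x zero    = refl
fold-suc f x (suc t) = cong f (fold-suc f x t)

fold-injective : Injective _≡_ _≡_ f → ∀ t → fold x f t ≡ fold y f t → x ≡ y
fold-injective inj zero    eq = eq
fold-injective inj (suc t) eq = fold-injective inj t (inj eq)

fold-period : ∀ {p} t → fold x f p ≡ x → fold x f (t * p) ≡ x
fold-period                 zero    eq = refl
fold-period {x = x} {f = f} {p} (suc t) eq = begin
  fold x f (p + t * p)          ≡⟨ fold-+ x f p ⟩
  fold (fold x f (t * p)) f p   ≡⟨ cong (λ z → fold z f p) (fold-period {p = p} t eq) ⟩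
  fold x f p                    ≡⟨ eq ⟩
  x                             ∎
  where open ≡-Reasoning

fold-cancel : Injective _≡_ _≡_ f → ∀ s {t} → fold x f s ≡ fold x f (s + t) → fold x f t ≡ x
fold-cancel {f = f} {x = x} inj s eq = sym (fold-injective inj s (trans eq (fold-+ x f s)))

fold-repeat : Injective _≡_ _≡_ f → ∀ {s t} → s < t → fold x f s ≡ fold x f t →
              ∃[ p ] suc p ≤ t × fold x f (suc p) ≡ x
fold-repeat {f = f} {x = x} inj {s} {t} s<t eq with p , refl ← m≤n⇒∃[o]m+o≡n s<t =
  p , s≤s (m≤n+m p s) , fold-cancel inj s (trans eq (cong (fold x f) (sym (+-suc s p))))

-- Among the first `N + 1` iterates two coincide; injectivity cancels their common initial steps, so
-- the path returns to `x` itself.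
periodic : {f : Fin N → Fin N} → Injective _≡_ _≡_ f → ∀ x →
           ∃[ p ] suc p ≤ N × fold x f (suc p) ≡ x
periodic {N} {f} inj x
  with i , j , i<j , eq ← Fin.pigeonhole (n<1+n N) (fold x f ∘ toℕ)
  with p , p<j , eq′ ← fold-repeat inj i<j eq
  = p , ≤-trans p<j (Fin.toℕ≤pred[n] j) , eq′

-- Orbits

-- The equivalence closure lets paths be reversed and glued freely while `f` is being altered;
-- `reach` turns them back into iterates.
Orbit : (Fin N → Fin N) → Fin N → Fin N → Set
Orbit f = EqClosure (λ x y → f x ≡ y)

step : Orbit f x (f x)
step = Eq.return refl

Transitive : (Fin N → Fin N) → Set
Transitive f = ∀ x y → Orbit f x y

reach : Injective _≡_ _≡_ f → Orbit f x y → ∃[ t ] fold x f t ≡ y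
reach {f = f} inj = Eq.fold reach-isEquivalence (1 ,_)
  where
  reach-sym : ∀ {x y} → ∃[ t ] fold x f t ≡ y → ∃[ t ] fold y f t ≡ x
  -- With `suc p` a period of `x`, `t * p` further steps complete `t` full turns.
  reach-sym {x} (t , refl) with p , _ , eq ← periodic inj x = t * p , (begin
    fold (fold x f t) f (t * p)  ≡⟨ fold-+ x f (t * p) ⟨
    fold x f (t * p + t)         ≡⟨ cong (fold x f) (trans (+-comm (t * p) t) (sym (*-suc t p))) ⟩
    fold x f (t * suc p)         ≡⟨ fold-period t eq ⟩
    x                            ∎)
    where open ≡-Reasoning
  reach-isEquivalence : IsEquivalence (λ x y → ∃[ t ] fold x f t ≡ y)
  reach-isEquivalence = record
    { refl  = 0 , refl
    ; sym   = reach-sym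
    ; trans = λ { {x} (s , refl) (t , refl) → t + s , fold-+ x f t }
    }

reach-below : Injective _≡_ _≡_ f → ∀ {p} → fold x f (suc p) ≡ x → Orbit f x y →
              ∃[ i ] fold x f (toℕ {suc p} i) ≡ y
reach-below {f = f} {x = x} {y = y} inj {p} eq x~y with t , t-eq ← reach inj x~y =
  fromℕ< (m%n<n t (suc p)) , (begin
  fold x f (toℕ (fromℕ< (m%n<n t (suc p))))             ≡⟨ cong (fold x f) (Fin.toℕ-fromℕ< (m%n<n t (suc p))) ⟩
  fold x f (t % suc p)                                  ≡⟨ cong (λ z → fold z f (t % suc p)) (fold-period {f = f} {p = suc p} (t / suc p) eq) ⟨
  fold (fold x f (t / suc p * suc p)) f (t % suc p)     ≡⟨ fold-+ x f (t % suc p) ⟨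
  fold x f (t % suc p + t / suc p * suc p)              ≡⟨ cong (fold x f) (m≡m%n+[m/n]*n t (suc p)) ⟨
  fold x f t                                            ≡⟨ t-eq ⟩
  y                                                     ∎)
  where open ≡-Reasoning

-- Exponents below any period already reach all `N` points, and picking one for each point is
-- injective.
period-≥ : {f : Fin N → Fin N} → Injective _≡_ _≡_ f → Transitive f →
           ∀ {x p} → fold x f (suc p) ≡ x → N ≤ suc p
period-≥ {N} {f} inj tr {x} {p} eq = Fin.injective⇒≤ {f = proj₁ ∘ below} λ {y} {z} i≡j →
  trans (sym (proj₂ (below y))) (trans (cong (fold x f ∘ toℕ) i≡j) (proj₂ (below z)))
  where
  below : ∀ y → ∃[ i ] fold x f (toℕ {suc p} i) ≡ y
  below y = reach-below inj {p} eq (tr x y)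

period : {f : Fin N → Fin N} → Injective _≡_ _≡_ f → Transitive f → ∀ x → fold x f N ≡ x
period inj tr x with p , p<N , eq ← periodic inj x =
  trans (cong (fold x _) (≤-antisym (period-≥ inj tr eq) p<N)) eq

fold-distinct : {f : Fin N → Fin N} → Injective _≡_ _≡_ f → Transitive f →
                ∀ x {i j : Fin N} → i Fin.< j → fold x f (toℕ i) ≢ fold x f (toℕ j)
fold-distinct inj tr x {j = j} i<j eq with p , p<j , eq′ ← fold-repeat inj i<j eq =
  <-irrefl refl (≤-<-trans (≤-trans (period-≥ inj tr eq′) p<j) (Fin.toℕ<n j))

fold-toℕ-injective : {f : Fin N → Fin N} → Injective _≡_ _≡_ f → Transitive f →
                     ∀ x → Injective _≡_ _≡_ (λ (i : Fin N) → fold x f (toℕ i))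
fold-toℕ-injective inj tr x {i} {j} eq with Fin.<-cmp i j
... | tri< i<j _ _ = contradiction eq (fold-distinct inj tr x i<j)
... | tri≈ _ i≡j _ = i≡j
... | tri> _ _ j<i = contradiction (sym eq) (fold-distinct inj tr x j<i)

fold-toℕ-surjective : {f : Fin N → Fin N} → Injective _≡_ _≡_ f → Transitive f →
                      ∀ x y → ∃[ i ] fold x f (toℕ {N} i) ≡ y
fold-toℕ-surjective {suc _} inj tr x y = reach-below inj (period inj tr x) (tr x y)

-- Transpositions

-- `g` is `f` preceded by the transposition of `x` and `y`.
record Transposed (f g : Fin N → Fin N) (x y : Fin N) : Set where
  field
    at-x : g x ≡ f y
    at-y : g y ≡ f x
    else : ∀ {z} → z ≢ x → z ≢ y → g z ≡ f z

module _ {f g : Fin N → Fin N} {x y : Fin N} (tr : Transposed f g x y) where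
  open Transposed tr

  private
    step-mod : ∀ z → Orbit g z (f z) ⊎ (z ≡ x × Orbit g y (f z)) ⊎ (z ≡ y × Orbit g x (f z))
    step-mod z with z Fin.≟ x | z Fin.≟ y
    ... | yes refl | _        = inj₂ (inj₁ (refl , Eq.return at-y))
    ... | no _     | yes refl = inj₂ (inj₂ (refl , Eq.return at-x))
    ... | no z≢x   | no z≢y   = inj₁ (Eq.return (else z≢x z≢y))

  -- The arrows of `f` leaving `x` and `y` reappear in `g` with their sources exchanged; all others
  -- are unchanged. Once `h` joins `x` and `y`, the exchange is invisible. Keeping `h` apart from
  -- `g` allows the rejoining to come from a later alteration.
  orbit-merge : ∀ {h} → Orbit g ⇒ Orbit h → Orbit h x y → Orbit f ⇒ Orbit h
  orbit-merge {h} g⇒h x~y = λ o → (λ { {z} refl → lemma z }) Eq.⋆ $ o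
    where
    lemma : ∀ z → Orbit h z (f z)
    lemma z with step-mod z
    ... | inj₁ o                  = g⇒h o
    ... | inj₂ (inj₁ (refl , o))  = x~y ◅◅ g⇒h o
    ... | inj₂ (inj₂ (refl , o))  = Eq.symmetric _ x~y ◅◅ g⇒h o

  private
    Near : Fin N → Set
    Near z = Orbit g z x ⊎ Orbit g z y

    -- The equivalence generated by the orbits of `g` and the identification of `x` with `y`. It
    -- contains every step of `f`, so the `f`-orbit of `x` breaks into at most the `g`-orbits of `x`
    -- and `y`.
    Split : Fin N → Fin N → Set
    Split z w = Orbit g z w ⊎ (Near z × Near w)

    near : ∀ {z w} → Orbit g z w → Near w → Near z
    near o (inj₁ w~x) = inj₁ (o ◅◅ w~x)
    near o (inj₂ w~y) = inj₂ (o ◅◅ w~y)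

    split-isEquivalence : IsEquivalence Split
    split-isEquivalence = record
      { refl  = inj₁ ε
      ; sym   = λ { (inj₁ o) → inj₁ (Eq.symmetric _ o) ; (inj₂ (a , b)) → inj₂ (b , a) }
      ; trans = λ { (inj₁ o) (inj₁ o′)            → inj₁ (o ◅◅ o′)
                  ; (inj₁ o) (inj₂ (a , b))       → inj₂ (near o a , b)
                  ; (inj₂ (a , b)) (inj₁ o)       → inj₂ (a , near (Eq.symmetric _ o) b)
                  ; (inj₂ (a , _)) (inj₂ (_ , b)) → inj₂ (a , b) }
      }

  orbit-split : ∀ {z} → Orbit f x z → Orbit g z x ⊎ Orbit g z y
  orbit-split o with Eq.fold split-isEquivalence (λ { {z} refl → lemma z }) o
    where
    lemma : ∀ z → Split z (f z)
    lemma z with step-mod z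
    ... | inj₁ o                 = inj₁ o
    ... | inj₂ (inj₁ (refl , o)) = inj₂ (inj₁ ε , inj₂ (Eq.symmetric _ o))
    ... | inj₂ (inj₂ (refl , o)) = inj₂ (inj₂ ε , inj₁ (Eq.symmetric _ o))
  ... | inj₁ x~z     = inj₁ (Eq.symmetric _ x~z)
  ... | inj₂ (_ , b) = b

  -- Follow f from f y = g x until y or x shows up; up to there f and g agree.
  orbit-dichotomy : Injective _≡_ _≡_ f → Orbit f x y ⊎ Orbit g x y
  orbit-dichotomy inj with p , _ , eq ← periodic inj y with walk p (f y) (trans (fold-suc f y p) eq)
    where
    walk : ∀ t u → fold u f t ≡ y → Orbit f u x ⊎ Orbit g u y
    walk zero    u refl = inj₂ ε
    walk (suc t) u eq with u Fin.≟ x | u Fin.≟ y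
    ... | yes refl | _        = inj₁ ε
    ... | no _     | yes refl = inj₂ ε
    ... | no u≢x   | no u≢y with walk t (f u) (trans (fold-suc f u t) eq)
    ...   | inj₁ o = inj₁ (step ◅◅ o)
    ...   | inj₂ o = inj₂ (Eq.return (else u≢x u≢y) ◅◅ o)
  ... | inj₁ o = inj₁ (Eq.symmetric _ (step ◅◅ o))
  ... | inj₂ o = inj₂ (Eq.return at-x ◅◅ o)

-- Lists and words

∷ʳ-shift : ∀ (w : Word k) a → shift (w ∷ʳ a) ≡ a ∷ w
∷ʳ-shift w a = via (w ∷ʳ a) refl
  where
  via : ∀ v → v ≡ w ∷ʳ a → shift v ≡ a ∷ w
  via v eq with initLast v
  ... | []       = contradiction (List.++-conicalʳ w _ (sym eq)) λ ()
  ... | v′ ∷ʳ′ b with refl , refl ← List.∷ʳ-injective v′ w eq = refl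

last-∷ʳ : ∀ (xs : List A) x → last (xs ∷ʳ x) ≡ just x
last-∷ʳ []           x = refl
last-∷ʳ (_ ∷ [])     x = refl
last-∷ʳ (_ ∷ y ∷ xs) x = last-∷ʳ (y ∷ xs) x

applyDownFrom-cong : ∀ {f g : ℕ → A} → f ≗ g → applyDownFrom f ≗ applyDownFrom g
applyDownFrom-cong f≗g zero    = refl
applyDownFrom-cong f≗g (suc n) = cong₂ _∷_ (f≗g n) (applyDownFrom-cong f≗g n)

last-applyDownFrom : ∀ (f : ℕ → A) n .{{_ : NonZero n}} → last (applyDownFrom f n) ≡ just (f 0)
last-applyDownFrom f (suc n) =
  trans (cong last (sym (List.applyDownFrom-∷ʳ f n))) (last-∷ʳ (applyDownFrom (f ∘ suc) n) (f 0))

-- `f 0` leaves at the end of the word and the equal letter `f n` enters at the front.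
shift-applyDownFrom : ∀ (f : ℕ → Fin k) n → f n ≡ f 0 →
                      shift (applyDownFrom f n) ≡ applyDownFrom (f ∘ suc) n
shift-applyDownFrom f zero    _     = refl
shift-applyDownFrom f (suc n) fn≡f0 = begin
  shift (applyDownFrom f (suc n))             ≡⟨ cong shift (List.applyDownFrom-∷ʳ f n) ⟨
  shift (applyDownFrom (f ∘ suc) n ∷ʳ f 0)    ≡⟨ ∷ʳ-shift (applyDownFrom (f ∘ suc) n) (f 0) ⟩
  f 0 ∷ applyDownFrom (f ∘ suc) n             ≡⟨ cong (_∷ applyDownFrom (f ∘ suc) n) fn≡f0 ⟨
  applyDownFrom (f ∘ suc) (suc n)             ∎
  where open ≡-Reasoning

iterate-tabulate : ∀ (f : A → A) x n → iterate f x n ≡ tabulate {n = n} (fold x f ∘ toℕ)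
iterate-tabulate f x zero    = refl
iterate-tabulate f x (suc n) =
  cong (x ∷_) (trans (iterate-tabulate f (f x) n) (List.tabulate-cong (fold-suc f x ∘ toℕ)))

iterate-map : ∀ {B : Set} {f : A → A} {g : B → B} (h : A → B) → (∀ x → g (h x) ≡ h (f x)) →
              ∀ x n → iterate g (h x) n ≡ map h (iterate f x n)
iterate-map h comm x zero    = refl
iterate-map {f = f} {g} h comm x (suc n) =
  cong (h x ∷_) (trans (cong (λ y → iterate g y n) (comm x)) (iterate-map h comm (f x) n))

-- Both lists are free of repetitions and contain every point.
iterate-transitive : Injective _≡_ _≡_ f → Transitive f → ∀ (x : Fin N) → iterate f x N ↭ allFin N
iterate-transitive {N} {f} inj tr x = ↭-trans (↭-reflexive (iterate-tabulate f x N)) $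
  ∼bag⇒↭ $ unique∧set⇒bag
    (Unique.tabulate⁺ (fold-toℕ-injective inj tr x)) (Unique.allFin⁺ N)
    (λ {y} → mk⇔ (λ _ → ∈-allFin y) λ _ → let i , eq = fold-toℕ-surjective inj tr x y in
      subst (_∈ _) eq (∈-tabulate⁺ i))

tabulate-cast : ∀ {m} (eq : m ≡ n) (f : Fin n → A) → tabulate f ≡ tabulate (f ∘ cast eq)
tabulate-cast refl f = List.tabulate-cong (cong f ∘ sym ∘ Fin.cast-is-id refl)

tabulate-+ : ∀ m (f : Fin (m + n) → A) →
             tabulate f ≡ tabulate (f ∘ (Fin._↑ˡ n)) ++ tabulate (f ∘ (m Fin.↑ʳ_))
tabulate-+ zero    f = refl
tabulate-+ (suc m) f = cong (f zero ∷_) (tabulate-+ m (f ∘ suc))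

tabulate-combine : ∀ n (f : Fin (n * k) → A) →
                   tabulate f ≡ concat (tabulate λ q → tabulate (f ∘ combine {n} q))
tabulate-combine         zero    f = refl
tabulate-combine {k = k} (suc n) f =
  trans (tabulate-+ k f) (cong (tabulate (f ∘ (Fin._↑ˡ n * k)) ++_) (tabulate-combine n (f ∘ (k Fin.↑ʳ_))))

last-tabulate : ∀ n (f : Fin (suc n) → A) → last (tabulate f) ≡ just (f (fromℕ n))
last-tabulate zero    f = refl
last-tabulate (suc n) f = last-tabulate n (f ∘ suc)

-- Inside a block neighbours differ by injectivity; the last condition covers the seams. Blocks of
-- length `suc j` are nonempty, so a seam only involves two consecutive blocks.
linked-blocks : ∀ n {j} (f : Fin n → Fin (suc j) → A) → (∀ q → Injective _≡_ _≡_ (f q)) →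
  (∀ {p q} → toℕ q ≡ suc (toℕ p) → f p (fromℕ j) ≢ f q zero) →
  Linked _≢_ (concat (tabulate (tabulate ∘ f)))
linked-blocks zero    f inj sep = []
linked-blocks (suc n) {j} f inj sep = Linked.++⁺
  (AllPairs⇒Linked (Unique.tabulate⁺ (inj zero)))
  (subst (λ x → Connected _≢_ x (head (concat (tabulate (tabulate ∘ f ∘ suc)))))
    (sym (last-tabulate j (f zero))) (boundary n f sep))
  (linked-blocks n (f ∘ suc) (inj ∘ suc) (sep ∘ cong suc))
  where
  boundary : ∀ n (f : Fin (suc n) → Fin (suc j) → A) →
    (∀ {p q} → toℕ q ≡ suc (toℕ p) → f p (fromℕ j) ≢ f q zero) →
    Connected _≢_ (just (f zero (fromℕ j))) (head (concat (tabulate (tabulate ∘ f ∘ suc))))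
  boundary zero    f sep = just-nothing
  boundary (suc n) f sep = just (sep {zero} {suc zero} refl)

derun-linked : ∀ {w : Word k} → Linked _≢_ w → derun Fin._≟_ w ≡ w
derun-linked []                       = refl
derun-linked [-]                      = refl
derun-linked {w = a ∷ b ∷ w} (a≢b ∷ l) =
  trans (List.derun-accept Fin._≟_ w a≢b) (cong (a ∷_) (derun-linked l))

tabulate-isAlphabetPermutation : ∀ (π : Permutation′ k) → IsAlphabetPermutation (tabulate (π ⟨$⟩ʳ_))
tabulate-isAlphabetPermutation π a =
  cast (sym len) (π ⟨$⟩ˡ a) , trans (List.lookup-tabulate (π ⟨$⟩ʳ_) _) (inverseʳ π) , unique
  where
  open ≡-Reasoning
  len = List.length-tabulate (π ⟨$⟩ʳ_)

  unique : ∀ {i} → lookup (tabulate (π ⟨$⟩ʳ_)) i ≡ a → cast (sym len) (π ⟨$⟩ˡ a) ≡ i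
  unique {i} eq = begin
    cast (sym len) (π ⟨$⟩ˡ a)                     ≡⟨ cong (λ a → cast (sym len) (π ⟨$⟩ˡ a)) at-i ⟨
    cast (sym len) (π ⟨$⟩ˡ (π ⟨$⟩ʳ cast len i))   ≡⟨ cong (cast (sym len)) (inverseˡ π) ⟩
    cast (sym len) (cast len i)                   ≡⟨ Fin.cast-involutive (sym len) len i ⟩
    i                                             ∎
    where
    at-i : π ⟨$⟩ʳ cast len i ≡ a
    at-i = begin
      π ⟨$⟩ʳ cast len i                                           ≡⟨ List.lookup-tabulate (π ⟨$⟩ʳ_) (cast len i) ⟨
      lookup (tabulate (π ⟨$⟩ʳ_)) (cast (sym len) (cast len i))   ≡⟨ cong (lookup (tabulate (π ⟨$⟩ʳ_))) (Fin.cast-involutive (sym len) len i) ⟩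
      lookup (tabulate (π ⟨$⟩ʳ_)) i                               ≡⟨ eq ⟩
      a                                                           ∎

-- Sorted lists with the same entries agree up to the equality of the order, which on words is
-- pointwise and hence propositional.
sort-unique : ∀ {xs ys : List (Word k)} → xs ↭ ys →
              Sorted (DecTotalOrder.totalOrder (lexicographic k)) ys → sort (lexicographic k) xs ≡ ys
sort-unique {k} {xs} xs↭ys ys↗ = Pointwise-≡⇒≡ $ Pointwise.map Pointwise-≡⇒≡ $
  ↗↭↗⇒≋ totalOrder (sort-↗ (lexicographic k) xs) ys↗
    (↭⇒↭ₛ′ (DecTotalOrder.Eq.isEquivalence (lexicographic k)) (↭-trans (sort-↭ (lexicographic k) xs) xs↭ys))
  where open DecTotalOrder (lexicographic k) using (totalOrder)

-- Standard permutations of alphabet-permutation powers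

-- For `σ` of this type, block `q` is the alphabet-permutation whose `r`-th letter is `σ q ⟨$⟩ʳ r`.
Blocks : ℕ → ℕ → Set
Blocks n k = Fin n → Permutation′ k

⟨$⟩ʳ-injective : ∀ (π : Permutation′ k) → Injective _≡_ _≡_ (π ⟨$⟩ʳ_)
⟨$⟩ʳ-injective π eq = trans (sym (inverseˡ π)) (trans (cong (π ⟨$⟩ˡ_) eq) (inverseˡ π))

transpose-at-i : ∀ (r s : Fin k) → PC.transpose r s r ≡ s
transpose-at-i r s rewrite dec-true (r Fin.≟ r) refl = refl

transpose-at-j : ∀ (r s : Fin k) → PC.transpose r s s ≡ r
transpose-at-j r s with s Fin.≟ r
... | yes s≡r = s≡r
... | no _ rewrite dec-true (s Fin.≟ s) refl = refl

transpose-else : ∀ (r s : Fin k) {t} → t ≢ r → t ≢ s → PC.transpose r s t ≡ t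
transpose-else r s {t} t≢r t≢s
  rewrite dec-false (t Fin.≟ r) t≢r | dec-false (t Fin.≟ s) t≢s = refl

module Standard (n k : ℕ) where

  abstract
    position : Fin n → Fin k → Fin (k * n)
    position q r = cast (*-comm n k) (combine q r)

    block : Fin (k * n) → Fin n
    block x = proj₁ (remQuot k (cast (*-comm k n) x))

    offset : Fin (k * n) → Fin k
    offset x = proj₂ (remQuot {n} k (cast (*-comm k n) x))

    block-position : ∀ q r → block (position q r) ≡ q
    block-position q r = cong proj₁ (trans
      (cong (remQuot k) (Fin.cast-involutive (*-comm k n) (*-comm n k) (combine q r)))
      (Fin.remQuot-combine q r))

    offset-position : ∀ q r → offset (position q r) ≡ r
    offset-position q r = cong proj₂ (trans
      (cong (remQuot {n} k) (Fin.cast-involutive (*-comm k n) (*-comm n k) (combine q r)))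
      (Fin.remQuot-combine q r))

    position-block-offset : ∀ x → position (block x) (offset x) ≡ x
    position-block-offset x = trans
      (cong (cast (*-comm n k)) (Fin.combine-remQuot {n} k (cast (*-comm k n) x)))
      (Fin.cast-involutive (*-comm n k) (*-comm k n) x)

    toℕ-position : ∀ q r → toℕ (position q r) ≡ k * toℕ q + toℕ r
    toℕ-position q r = trans (Fin.toℕ-cast (*-comm n k) (combine q r)) (Fin.toℕ-combine q r)

    tabulate-position : ∀ {A : Set} (h : Fin (k * n) → A) →
      tabulate h ≡ concat (tabulate λ q → tabulate (h ∘ position q))
    tabulate-position h =
      trans (tabulate-cast (*-comm n k) h) (tabulate-combine n (h ∘ cast (*-comm n k)))

    block-<⇒< : ∀ {x y} → block x Fin.< block y → x Fin.< y
    block-<⇒< {x} {y} b<b′ = subst₂ _<_ (toℕ-cast x) (toℕ-cast y) (subst₂ Fin._<_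
      (Fin.combine-remQuot {n} k _) (Fin.combine-remQuot {n} k _)
      (Fin.combine-monoˡ-< (offset x) (offset y) b<b′))
      where
      toℕ-cast : ∀ x → toℕ (cast (*-comm k n) x) ≡ toℕ x
      toℕ-cast = Fin.toℕ-cast (*-comm k n)

  toℕ-block-offset : ∀ x → toℕ x ≡ k * toℕ (block x) + toℕ (offset x)
  toℕ-block-offset x =
    trans (cong toℕ (sym (position-block-offset x))) (toℕ-position (block x) (offset x))

  letter : Blocks n k → Fin (k * n) → Fin k
  letter σ x = σ (block x) ⟨$⟩ʳ offset x

  letter-position : ∀ σ q r → letter σ (position q r) ≡ σ q ⟨$⟩ʳ r
  letter-position σ q r = cong₂ (λ q r → σ q ⟨$⟩ʳ r) (block-position q r) (offset-position q r)

  abstract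
    -- The i-th occurrence of a in the BWT is sent to the i-th occurrence of a in
    -- the sorted BWT; each block contains a exactly once.
    standard : Blocks n k → Fin (k * n) → Fin (k * n)
    standard σ x = combine (letter σ x) (block x)

    standard-def : ∀ σ x → standard σ x ≡ combine (letter σ x) (block x)
    standard-def σ x = refl

  toℕ-standard : ∀ σ x → toℕ (standard σ x) ≡ n * toℕ (letter σ x) + toℕ (block x)
  toℕ-standard σ x = trans (cong toℕ (standard-def σ x)) (Fin.toℕ-combine (letter σ x) (block x))

  standard-position : ∀ σ q r → standard σ (position q r) ≡ combine (σ q ⟨$⟩ʳ r) q
  standard-position σ q r =
    trans (standard-def σ _) (cong₂ combine (letter-position σ q r) (block-position q r))

  -- The image determines the letter and the block, and inside a block the letter determines the
  -- offset.
  standard-injective : ∀ σ → Injective _≡_ _≡_ (standard σ)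
  standard-injective σ {x} {y} eq
    with letters , blocks ← Fin.combine-injective (letter σ x) (block x) (letter σ y) (block y)
      (trans (sym (standard-def σ x)) (trans eq (standard-def σ y))) =
    begin
      x                               ≡⟨ position-block-offset x ⟨
      position (block x) (offset x)   ≡⟨ cong₂ position blocks offsets ⟩
      position (block y) (offset y)   ≡⟨ position-block-offset y ⟩
      y                               ∎
    where
    open ≡-Reasoning
    offsets : offset x ≡ offset y
    offsets = ⟨$⟩ʳ-injective (σ (block x))
      (trans letters (cong (λ q → σ q ⟨$⟩ʳ offset y) (sym blocks)))

  abstract
    -- The transposition acts on offsets, before `σ q`: two places of the block exchange their
    -- letters.
    swap : Blocks n k → Fin n → Fin k → Fin k → Blocks n k
    swap σ q r s = updateAt σ q (transpose r s ∘ₚ_)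

    swap-block : ∀ σ q r s t → swap σ q r s q ⟨$⟩ʳ t ≡ σ q ⟨$⟩ʳ PC.transpose r s t
    swap-block σ q r s t = cong (_⟨$⟩ʳ t) (updateAt-updates q σ)

    swap-other : ∀ σ q r s {p} → p ≢ q → swap σ q r s p ≡ σ p
    swap-other σ q r s {p} p≢q = updateAt-minimal p q σ p≢q

  swap-at-i : ∀ σ q r s → swap σ q r s q ⟨$⟩ʳ r ≡ σ q ⟨$⟩ʳ s
  swap-at-i σ q r s = trans (swap-block σ q r s r) (cong (σ q ⟨$⟩ʳ_) (transpose-at-i r s))

  swap-else : ∀ σ q r s {t} → t ≢ r → t ≢ s → swap σ q r s q ⟨$⟩ʳ t ≡ σ q ⟨$⟩ʳ t
  swap-else σ q r s {t} t≢r t≢s =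
    trans (swap-block σ q r s t) (cong (σ q ⟨$⟩ʳ_) (transpose-else r s t≢r t≢s))

  -- An image depends on the letter and the block alone, so exchanging two letters within one block
  -- exchanges exactly two images.
  swap-transposed : ∀ σ q r s →
    Transposed (standard σ) (standard (swap σ q r s)) (position q r) (position q s)
  swap-transposed σ q r s = record
    { at-x = via (transpose-at-i r s)
    ; at-y = via (transpose-at-j r s)
    ; else = λ {z} z≢x z≢y → subst (λ z → standard (swap σ q r s) z ≡ standard σ z)
        (position-block-offset z) (unchanged _ _
          (z≢x ∘ trans (sym (position-block-offset z))) (z≢y ∘ trans (sym (position-block-offset z))))
    }
    where
    open ≡-Reasoning
    via : ∀ {t u} → PC.transpose r s t ≡ u →
          standard (swap σ q r s) (position q t) ≡ standard σ (position q u)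
    via {t} {u} eq = begin
      standard (swap σ q r s) (position q t)    ≡⟨ standard-position (swap σ q r s) q t ⟩
      combine (swap σ q r s q ⟨$⟩ʳ t) q         ≡⟨ cong (flip combine q) (swap-block σ q r s t) ⟩
      combine (σ q ⟨$⟩ʳ PC.transpose r s t) q   ≡⟨ cong (λ v → combine (σ q ⟨$⟩ʳ v) q) eq ⟩
      combine (σ q ⟨$⟩ʳ u) q                    ≡⟨ standard-position σ q u ⟨
      standard σ (position q u)                 ∎
    unchanged : ∀ p t → position p t ≢ position q r → position p t ≢ position q s →
                standard (swap σ q r s) (position p t) ≡ standard σ (position p t)
    unchanged p t ≢x ≢y with p Fin.≟ q
    ... | yes refl = via (transpose-else r s (≢x ∘ cong (position q)) (≢y ∘ cong (position q)))
    ... | no p≢q = begin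
      standard (swap σ q r s) (position p t)    ≡⟨ standard-position (swap σ q r s) p t ⟩
      combine (swap σ q r s p ⟨$⟩ʳ t) p         ≡⟨ cong (λ π → combine (π ⟨$⟩ʳ t) p) (swap-other σ q r s p≢q) ⟩
      combine (σ p ⟨$⟩ʳ t) p                    ≡⟨ standard-position σ p t ⟨
      standard σ (position p t)                 ∎

  -- Merging the orbits through a block

  Orbitˢ : Blocks n k → Fin (k * n) → Fin (k * n) → Set
  Orbitˢ σ = Orbit (standard σ)

  Hub : Blocks n k → Fin n → Set
  Hub σ q = ∀ r s → Orbitˢ σ (position q r) (position q s)

  -- A stage of the construction confined to one block. Since orbits can only grow, everything
  -- joined earlier stays joined.
  record _⊑[_]_ (σ : Blocks n k) (q : Fin n) (τ : Blocks n k) : Set where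
    field
      agree  : ∀ {p} → p ≢ q → τ p ≡ σ p
      orbits : Orbitˢ σ ⇒ Orbitˢ τ
  open _⊑[_]_ public

  ⊑-refl : ∀ {q σ} → σ ⊑[ q ] σ
  ⊑-refl = record { agree = λ _ → refl ; orbits = λ o → o }

  ⊑-trans : ∀ {q σ τ υ} → σ ⊑[ q ] τ → τ ⊑[ q ] υ → σ ⊑[ q ] υ
  ⊑-trans a b = record { agree = λ p≢q → trans (agree b p≢q) (agree a p≢q) ; orbits = orbits b ∘ orbits a }

  -- The swap itself may split an orbit; this does no harm as soon as `τ` rejoins the two places.
  swap-⊑ : ∀ {σ τ q r s} → swap σ q r s ⊑[ q ] τ →
           Orbitˢ τ (position q r) (position q s) → σ ⊑[ q ] τ
  swap-⊑ {σ = σ} {q = q} {r} {s} swap⊑τ o = record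
    { agree  = λ {p} p≢q → trans (agree swap⊑τ p≢q) (swap-other σ q r s p≢q)
    ; orbits = orbit-merge (swap-transposed σ q r s) (orbits swap⊑τ) o
    }

  swap-dichotomy : ∀ σ q r s →
    Orbitˢ σ (position q r) (position q s) ⊎ Orbitˢ (swap σ q r s) (position q r) (position q s)
  swap-dichotomy σ q r s = orbit-dichotomy (swap-transposed σ q r s) (standard-injective σ)

  -- When the two places lie in different orbits, exchanging their letters merges these.
  join-offset : ∀ σ q r s →
    ∃[ τ ] σ ⊑[ q ] τ × Orbitˢ τ (position q r) (position q s)
  join-offset σ q r s with swap-dichotomy σ q r s
  ... | inj₁ o = σ , ⊑-refl , o
  ... | inj₂ o = swap σ q r s , swap-⊑ ⊑-refl o , o

  join-offsets : ∀ σ q r ss →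
    ∃[ τ ] σ ⊑[ q ] τ × All (λ s → Orbitˢ τ (position q r) (position q s)) ss
  join-offsets σ q r []       = σ , ⊑-refl , []
  join-offsets σ q r (s ∷ ss)
    with τ , σ⊑τ , o  ← join-offset σ q r s
    with υ , τ⊑υ , os ← join-offsets τ q r ss
    = υ , ⊑-trans σ⊑τ τ⊑υ , orbits τ⊑υ o ∷ os

  hub : Fin k → ∀ σ q → ∃[ τ ] σ ⊑[ q ] τ × Hub τ q
  hub r₀ σ q with τ , σ⊑τ , os ← join-offsets σ q r₀ (allFin k) =
    τ , σ⊑τ , λ r s → Eq.symmetric _ (All.lookup os (∈-allFin r)) ◅◅ All.lookup os (∈-allFin s)

-- Choosing the blocks one by one while keeping the seams unclustered.

toℕ-pred : ∀ {m} (i : Fin m) → toℕ (Fin.pred i) ≡ pred (toℕ i)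
toℕ-pred zero    = refl
toℕ-pred (suc i) = Fin.toℕ-inject₁ i

module _ {n k : ℕ} where
  open Standard n k

  -- Swapping the images of r₀ and r₁ may split the orbit; a second swap, chosen by
  -- the part that r₂ falls into, reunites it and again leaves another image at r₀.
  move-first : ∀ {r₀ r₁ r₂} → r₁ ≢ r₀ → r₂ ≢ r₀ → r₂ ≢ r₁ → ∀ σ q → Hub σ q →
    ∃[ τ ] σ ⊑[ q ] τ × τ q ⟨$⟩ʳ r₀ ≢ σ q ⟨$⟩ʳ r₀
  move-first {r₀} {r₁} {r₂} r₁≢r₀ r₂≢r₀ r₂≢r₁ σ q h = reunite (orbit-split (swap-transposed σ q r₀ r₁) (h r₀ r₂))
    where
    τ = swap σ q r₀ r₁

    at : Fin k → Fin (k * n)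
    at = position q

    moved : ∀ {a r} → r ≢ r₀ → a ≡ σ q ⟨$⟩ʳ r → a ≢ σ q ⟨$⟩ʳ r₀
    moved r≢r₀ eq eq′ = r≢r₀ (⟨$⟩ʳ-injective (σ q) (trans (sym eq) eq′))

    whole : Orbitˢ τ (at r₀) (at r₁) → ∃[ υ ] σ ⊑[ q ] υ × υ q ⟨$⟩ʳ r₀ ≢ σ q ⟨$⟩ʳ r₀
    whole o = τ , swap-⊑ ⊑-refl o , moved r₁≢r₀ (swap-at-i σ q r₀ r₁)

    reunite : Orbitˢ τ (at r₂) (at r₀) ⊎ Orbitˢ τ (at r₂) (at r₁) →
              ∃[ υ ] σ ⊑[ q ] υ × υ q ⟨$⟩ʳ r₀ ≢ σ q ⟨$⟩ʳ r₀
    reunite (inj₁ 2~0) with swap-dichotomy τ q r₁ r₂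
    ... | inj₁ 1~2 = whole (Eq.symmetric _ (1~2 ◅◅ 2~0))
    -- This swap leaves the place `r₀` alone, which still carries the letter taken from `r₁`.
    ... | inj₂ 1~2 =
      let τ⊑υ = swap-⊑ ⊑-refl 1~2 in
      swap τ q r₁ r₂ ,
      swap-⊑ τ⊑υ (Eq.symmetric _ (1~2 ◅◅ orbits τ⊑υ 2~0)) ,
      moved r₁≢r₀ (trans (swap-else τ q r₁ r₂ (≢-sym r₁≢r₀) (≢-sym r₂≢r₀)) (swap-at-i σ q r₀ r₁))
    reunite (inj₂ 2~1) with swap-dichotomy τ q r₀ r₂
    ... | inj₁ 0~2 = whole (0~2 ◅◅ 2~1)
    -- Here `r₀` receives the letter of `r₂`, untouched by the first swap.
    ... | inj₂ 0~2 =
      let τ⊑υ = swap-⊑ ⊑-refl 0~2 in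
      swap τ q r₀ r₂ ,
      swap-⊑ τ⊑υ (0~2 ◅◅ orbits τ⊑υ 2~1) ,
      moved r₂≢r₀ (trans (swap-at-i τ q r₀ r₂) (swap-else σ q r₀ r₁ r₂≢r₀ r₂≢r₁))

  -- If the hub has `c` at `r₀`, any change of that letter suffices, and `move-first` keeps the hub
  -- since orbits only merge.
  hub-avoiding : ∀ {r₀ r₁ r₂} → r₁ ≢ r₀ → r₂ ≢ r₀ → r₂ ≢ r₁ → ∀ σ q c →
    ∃[ τ ] σ ⊑[ q ] τ × Hub τ q × τ q ⟨$⟩ʳ r₀ ≢ c
  hub-avoiding {r₀} r₁≢r₀ r₂≢r₀ r₂≢r₁ σ q c with τ , σ⊑τ , h ← hub r₀ σ q with τ q ⟨$⟩ʳ r₀ Fin.≟ c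
  ... | no ≢c = τ , σ⊑τ , h , ≢c
  ... | yes refl with υ , τ⊑υ , ≢c ← move-first r₁≢r₀ r₂≢r₀ r₂≢r₁ τ q h =
    υ , ⊑-trans σ⊑τ τ⊑υ , (λ r s → orbits τ⊑υ (h r s)) , ≢c

  -- The bound `t` restricts the condition to seams within the first `t` blocks, so that it can be
  -- carried along while later blocks are still to be chosen.
  Unclustered : Fin k → Fin k → Blocks n k → ℕ → Set
  Unclustered first final σ t = ∀ {p q} → toℕ q ≡ suc (toℕ p) → toℕ q < t →
    σ p ⟨$⟩ʳ final ≢ σ q ⟨$⟩ʳ first

  -- Treating block `t` keeps the earlier hubs, since orbits only merge, and the earlier seams,
  -- since no other block changes.
  unclustered-hubs : ∀ {r₀ r₁ r₂} → r₁ ≢ r₀ → r₂ ≢ r₀ → r₂ ≢ r₁ → ∀ final t → t ≤ n →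
    ∃[ σ ] (∀ {q} → toℕ q < t → Hub σ q) × Unclustered r₀ final σ t
  unclustered-hubs _ _ _ _ zero    _   = (λ _ → idₚ) , (λ ()) , (λ _ ())
  unclustered-hubs {r₀} r₁≢r₀ r₂≢r₀ r₂≢r₁ final (suc t) t<n
    with σ , hubs , unclustered ← unclustered-hubs r₁≢r₀ r₂≢r₀ r₂≢r₁ final t (<⇒≤ t<n)
    with q ← fromℕ< t<n in eq
    -- For the first block `Fin.pred q` is `q` itself, a mere default: no seam precedes that block.
    with τ , σ⊑τ , h , ≢c ← hub-avoiding r₁≢r₀ r₂≢r₀ r₂≢r₁ σ q (σ (Fin.pred q) ⟨$⟩ʳ final)
    = τ , hubs′ , unclustered′
    where
    q≡t : toℕ q ≡ t
    q≡t = trans (cong toℕ (sym eq)) (Fin.toℕ-fromℕ< t<n)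

    ≢q : ∀ {p} → toℕ p < t → p ≢ q
    ≢q p<t refl = <-irrefl q≡t p<t

    below : ∀ {p} → toℕ p < suc t → p ≡ q ⊎ toℕ p < t
    below p<1+t with m<1+n⇒m<n∨m≡n p<1+t
    ... | inj₁ p<t = inj₂ p<t
    ... | inj₂ p≡t = inj₁ (Fin.toℕ-injective (trans p≡t (sym q≡t)))

    hubs′ : ∀ {p} → toℕ p < suc t → Hub τ p
    hubs′ p<1+t with below p<1+t
    ... | inj₁ refl = h
    ... | inj₂ p<t  = λ r s → orbits σ⊑τ (hubs p<t r s)

    unclustered′ : Unclustered r₀ final τ (suc t)
    unclustered′ {p} {p′} p′≡1+p p′<1+t with below p′<1+t
    ... | inj₂ p′<t = subst₂ (λ π π′ → π ⟨$⟩ʳ _ ≢ π′ ⟨$⟩ʳ r₀)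
      (sym (agree σ⊑τ (≢q (<-trans (≤-reflexive (sym p′≡1+p)) p′<t))))
      (sym (agree σ⊑τ (≢q p′<t)))
      (unclustered p′≡1+p p′<t)
    ... | inj₁ refl = subst (λ π → π ⟨$⟩ʳ _ ≢ τ q ⟨$⟩ʳ r₀)
      (trans (cong σ pred≡p) (sym (agree σ⊑τ (≢q (≤-reflexive (trans (sym p′≡1+p) q≡t))))))
      (≢c ∘ sym)
      where
      pred≡p : Fin.pred q ≡ p
      pred≡p = Fin.toℕ-injective (trans (toℕ-pred q) (cong pred p′≡1+p))

  -- From hubs to a single cycle.

  block-< : 1 < k → ∀ x → 0 < toℕ x → toℕ (block x) < toℕ x
  block-< 1<k x 0<x with toℕ (block x) | toℕ-block-offset x
  ... | zero      | _  = 0<x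
  ... | b@(suc _) | eq = begin-strict
    b                        <⟨ m<m*n b k 1<k ⟩
    b * k                    ≡⟨ *-comm b k ⟩
    k * b                    ≤⟨ m≤m+n (k * b) (toℕ (offset x)) ⟩
    k * b + toℕ (offset x)   ≡⟨ eq ⟨
    toℕ x                    ∎
    where open ≤-Reasoning

  -- Some position in block q > 0 is sent to q itself, which lies in block ⌊q / k⌋ < q.
  hubs⇒transitive : 1 < k → {q₀ : Fin n} {a₀ : Fin k} → toℕ q₀ ≡ 0 → toℕ a₀ ≡ 0 →
                    ∀ σ → (∀ q → Hub σ q) → Transitive (standard σ)
  hubs⇒transitive 1<k {q₀} {a₀} q₀≡0 a₀≡0 σ hubs x y = to-origin x ◅◅ Eq.symmetric _ (to-origin y)
    where
    Goal : Fin n → Set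
    Goal q = ∀ r → Orbitˢ σ (position q r) (position q₀ a₀)

    goal-at : ∀ {x} → Goal (block x) → Orbitˢ σ x (position q₀ a₀)
    goal-at {x} goal = subst (flip (Orbitˢ σ) _) (position-block-offset x) (goal (offset x))

    descend : ∀ t → (∀ {s} → s < t → ∀ q → toℕ q ≡ s → Goal q) → ∀ q → toℕ q ≡ t → Goal q
    descend zero    _   q q≡0   r with refl ← Fin.toℕ-injective (trans q≡0 (sym q₀≡0)) = hubs q r a₀
    descend (suc t) rec q q≡1+t r =
      -- The place of the least letter `a₀` in block `q` has image `n * 0 + q`.
      hubs q r (σ q ⟨$⟩ˡ a₀) ◅◅ Eq.return to-w ◅◅ goal-at (rec block-w<1+t (block w) refl)
      where
      w : Fin (k * n)
      w = combine a₀ q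

      to-w : standard σ (position q (σ q ⟨$⟩ˡ a₀)) ≡ w
      to-w = trans (standard-position σ q _) (cong (flip combine q) (inverseʳ (σ q)))

      w≡1+t : toℕ w ≡ suc t
      w≡1+t = begin
        toℕ w                   ≡⟨ Fin.toℕ-combine a₀ q ⟩
        n * toℕ a₀ + toℕ q      ≡⟨ cong (λ a → n * a + toℕ q) a₀≡0 ⟩
        n * 0 + toℕ q           ≡⟨ cong (_+ toℕ q) (*-zeroʳ n) ⟩
        toℕ q                   ≡⟨ q≡1+t ⟩
        suc t                   ∎
        where open ≡-Reasoning

      block-w<1+t : toℕ (block w) < suc t
      block-w<1+t = subst (toℕ (block w) <_) w≡1+t (block-< 1<k w (subst (0 <_) (sym w≡1+t) z<s))

    to-origin : ∀ x → Orbitˢ σ x (position q₀ a₀)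
    to-origin x = goal-at (<-rec _ descend _ (block x) refl)

  unclustered-cycle : ∀ {r₀ r₁ r₂} → r₁ ≢ r₀ → r₂ ≢ r₀ → r₂ ≢ r₁ → 1 < k →
    {q₀ : Fin n} {a₀ : Fin k} → toℕ q₀ ≡ 0 → toℕ a₀ ≡ 0 → ∀ final →
    ∃[ σ ] Transitive (standard σ) × Unclustered r₀ final σ n
  unclustered-cycle r₁≢r₀ r₂≢r₀ r₂≢r₁ 1<k q₀≡0 a₀≡0 final
    with σ , hubs , unclustered ← unclustered-hubs r₁≢r₀ r₂≢r₀ r₂≢r₁ final n ≤-refl =
    σ , hubs⇒transitive 1<k q₀≡0 a₀≡0 σ (λ q → hubs (Fin.toℕ<n q)) , unclustered

-- Inverting the BWT

module Inversion {n k : ℕ} (σ : Blocks n k)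
                 (transitive : Transitive (Standard.standard n k σ)) where
  open Standard n k

  private
    φ : Fin (k * n) → Fin (k * n)
    φ = standard σ

    open DecTotalOrder (lexicographic k) using () renaming (_≤_ to _≤ₗ_)

  -- Reading a row backwards follows the standard permutation.
  suffix : ℕ → Fin (k * n) → Word k
  suffix j x = applyDownFrom (letter σ ∘ fold x φ) j

  -- One full turn of the cycle. By `sort-shifts-row` this is row `x` of the sorted matrix.
  row : Fin (k * n) → Word k
  row = suffix (k * n)

  -- The path closes after `k * n` steps, so the last letter, moved to the front, is the one met on
  -- returning to `x`.
  shift-row : ∀ x → shift (row x) ≡ row (φ x)
  shift-row x = trans
    (shift-applyDownFrom (letter σ ∘ fold x φ) (k * n)
      (cong (letter σ) (period (standard-injective σ) transitive x)))
    (applyDownFrom-cong (cong (letter σ) ∘ sym ∘ fold-suc φ x) (k * n))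

  last-row : ∀ x → last (row x) ≡ just (letter σ x)
  last-row x = last-applyDownFrom (letter σ ∘ fold x φ) (k * n)
    where instance _ = Fin.nonZeroIndex x

  -- Images `n a + q` compare by letter first and by block second. For equal letters the blocks
  -- decide the order of `x` and `y`, as a block contains each letter only once.
  letters-standard-≤ : ∀ {x y} → φ x Fin.≤ φ y →
    letter σ x Fin.< letter σ y ⊎ (letter σ x ≡ letter σ y × x Fin.≤ y)
  letters-standard-≤ {x} {y} φx≤φy with Fin.<-cmp (letter σ x) (letter σ y)
  ... | tri< a<b _ _ = inj₁ a<b
  ... | tri> _ _ b<a = contradiction φx≤φy (<⇒≱ (subst₂ Fin._<_
    (sym (standard-def σ y)) (sym (standard-def σ x)) (Fin.combine-monoˡ-< (block y) (block x) b<a)))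
  ... | tri≈ _ a≡b _ = inj₂ (a≡b , ordered)
    where
    blocks≤ : block x Fin.≤ block y
    blocks≤ = +-cancelˡ-≤ (n * toℕ (letter σ y)) _ _ (begin
      n * toℕ (letter σ y) + toℕ (block x)    ≡⟨ cong (λ a → n * toℕ a + toℕ (block x)) a≡b ⟨
      n * toℕ (letter σ x) + toℕ (block x)    ≡⟨ toℕ-standard σ x ⟨
      toℕ (φ x)                               ≤⟨ φx≤φy ⟩
      toℕ (φ y)                               ≡⟨ toℕ-standard σ y ⟩
      n * toℕ (letter σ y) + toℕ (block y)    ∎)
      where open ≤-Reasoning
    ordered : x Fin.≤ y
    ordered with m≤n⇒m<n∨m≡n blocks≤
    ... | inj₁ b<b′ = <⇒≤ (block-<⇒< b<b′)
    ... | inj₂ b≡b′ = ≤-reflexive (cong toℕ (standard-injective σ (trans (standard-def σ x)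
      (trans (cong₂ combine a≡b (Fin.toℕ-injective b≡b′)) (sym (standard-def σ y))))))

  -- The hypothesis sits at the far end of the path, where the first letter is read: that letter
  -- either decides the comparison or passes it one step back along the path.
  suffix-mono : ∀ j {x y} → fold x φ j Fin.≤ fold y φ j → suffix j x ≤ₗ suffix j y
  suffix-mono zero    _ = Lex.base tt
  suffix-mono (suc j) φx≤φy with letters-standard-≤ φx≤φy
  ... | inj₁ a<b         = Lex.this (<⇒≤ a<b , Fin.<⇒≢ a<b)
  ... | inj₂ (a≡b , x≤y) = Lex.next a≡b (suffix-mono j x≤y)

  row-mono : ∀ {x y} → x Fin.≤ y → row x ≤ₗ row y
  row-mono {x} {y} x≤y = suffix-mono (k * n) $
    subst₂ Fin._≤_ (sym (period (standard-injective σ) transitive x))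
                   (sym (period (standard-injective σ) transitive y)) x≤y

  length-row : ∀ x → length (row x) ≡ k * n
  length-row x = List.length-applyDownFrom (letter σ ∘ fold x φ) (k * n)

  shifts-row : ∀ x → shifts (row x) ≡ map row (iterate φ x (k * n))
  shifts-row x = trans (cong (iterate shift (row x)) (length-row x)) (iterate-map row shift-row x (k * n))

  sorted-rows : Sorted (DecTotalOrder.totalOrder (lexicographic k)) (map row (allFin (k * n)))
  sorted-rows = subst (Linked _) (sym (List.map-tabulate (λ x → x) row))
    (AllPairs⇒Linked (AllPairs.tabulate⁺-< (row-mono ∘ <⇒≤)))

  -- The shifts are the rows in the order of the cycle. With a single orbit they include one row for
  -- each index, and listing these by index is sorted.
  sort-shifts-row : ∀ x → sort (lexicographic k) (shifts (row x)) ≡ map row (allFin (k * n))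
  sort-shifts-row x = sort-unique (↭-trans (↭-reflexive (shifts-row x))
    (↭.map⁺ row (iterate-transitive (standard-injective σ) transitive x))) sorted-rows

  BWT-row : ∀ x → BWT (row x) ≡ tabulate (letter σ)
  BWT-row x = begin
    mapMaybe last (sort (lexicographic k) (shifts (row x)))
      ≡⟨ cong (mapMaybe last) (sort-shifts-row x) ⟩
    mapMaybe last (map row (allFin (k * n)))     ≡⟨ List.mapMaybe-map last row (allFin (k * n)) ⟩
    mapMaybe (last ∘ row) (allFin (k * n))       ≡⟨ List.mapMaybe-cong last-row (allFin (k * n)) ⟩
    mapMaybe (just ∘ letter σ) (allFin (k * n))  ≡⟨ List.mapMaybe-map just (letter σ) (allFin (k * n)) ⟨
    mapMaybe just (map (letter σ) (allFin (k * n)))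
      ≡⟨ List.mapMaybe-just _ ⟩
    map (letter σ) (allFin (k * n))              ≡⟨ List.map-tabulate (λ x → x) (letter σ) ⟩
    tabulate (letter σ)                          ∎
    where open ≡-Reasoning

  BWT-row-blocks : ∀ x → BWT (row x) ≡ concat (tabulate λ q → tabulate (σ q ⟨$⟩ʳ_))
  BWT-row-blocks x = trans (BWT-row x) (trans (tabulate-position (letter σ))
    (cong concat (List.tabulate-cong λ q → List.tabulate-cong (letter-position σ q))))

-- De Bruijn words

funToFin-injective : ∀ {m} {f g : Fin m → Fin n} → funToFin f ≡ funToFin g → f ≗ g
funToFin-injective eq j = trans (sym (Fin.finToFun-funToFin _ j))
  (trans (cong (λ c → finToFun c j) eq) (Fin.finToFun-funToFin _ j))

-- A missed value could be removed from the codomain, leaving an injection into too small a set.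
injective⇒surjective : ∀ {m} {f : Fin m → Fin n} → n ≤ m → Injective _≡_ _≡_ f → ∀ y → ∃[ x ] f x ≡ y
injective⇒surjective {n = suc n} {f = f} n<m inj y with Fin.any? (λ x → f x Fin.≟ y)
... | yes hit = hit
... | no miss = contradiction
  (Fin.injective⇒≤ {f = λ x → Fin.punchOut (≢y x)} (inj ∘ Fin.punchOut-injective (≢y _) (≢y _)))
  (<⇒≱ n<m)
  where
  ≢y : ∀ x → y ≢ f x
  ≢y x y≡fx = miss (x , sym y≡fx)

module _ {n k : ℕ} (σ : Blocks n (suc k))
         (transitive : Transitive (Standard.standard n (suc k) σ))
         (unclustered : Unclustered zero (fromℕ k) σ n) where
  open Inversion σ transitive

  row-completelyUnclustered : ∀ x → CompletelyUnclusteredBWT (row x)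
  row-completelyUnclustered x = begin
    length (derun Fin._≟_ (BWT (row x)))    ≡⟨ cong length (derun-linked linked) ⟩
    length (BWT (row x))                    ≡⟨ cong length (BWT-row x) ⟩
    length (tabulate (letter σ))            ≡⟨ List.length-tabulate (letter σ) ⟩
    suc k * n                               ≡⟨ length-row x ⟨
    length (row x)                          ∎
    where
    open ≡-Reasoning
    open Standard n (suc k) using (letter)
    linked : Linked _≢_ (BWT (row x))
    linked = subst (Linked _≢_) (sym (BWT-row-blocks x)) (linked-blocks n (λ q → σ q ⟨$⟩ʳ_)
      (λ q → ⟨$⟩ʳ-injective (σ q)) (λ {p} {q} eq → unclustered {p} {q} eq (Fin.toℕ<n q)))

row-isGeneralizedDeBruijn : (σ : Blocks (suc n) k)
  (transitive : Transitive (Standard.standard (suc n) k σ)) →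
  ∀ x → IsGeneralizedDeBruijn (suc n) (Inversion.row σ transitive x)
row-isGeneralizedDeBruijn σ transitive x =
  length-row x , block zero , tabulate (block ∘ suc) ,
  All.tabulate⁺ {f = block} (tabulate-isAlphabetPermutation ∘ σ) , BWT-row-blocks x
  where
  open Inversion σ transitive
  block = λ q → tabulate (σ q ⟨$⟩ʳ_)

-- Circular factors and base-k digits.

module _ {n k m : ℕ} .{{_ : NonZero k}} (n≡k^m : n ≡ k ^ m) (σ : Blocks n k)
         (transitive : Transitive (Standard.standard n k σ)) where
  open Standard n k
  open Inversion σ transitive

  private
    φ : Fin (k * n) → Fin (k * n)
    φ = standard σ

    φ-injective : Injective _≡_ _≡_ φ
    φ-injective = standard-injective σ

  toℕ-block : ∀ x → toℕ (block x) ≡ toℕ x / k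
  toℕ-block x = sym (begin
    toℕ x / k                                       ≡⟨ cong (_/ k) (toℕ-block-offset x) ⟩
    (k * toℕ (block x) + toℕ (offset x)) / k        ≡⟨ +-distrib-/-∣ˡ (toℕ (offset x)) (m∣m*n (toℕ (block x))) ⟩
    k * toℕ (block x) / k + toℕ (offset x) / k      ≡⟨ cong₂ _+_ (trans (cong (_/ k) (*-comm k _)) (m*n/n≡m (toℕ (block x)) k))
                                                                 (m<n⇒m/n≡0 (Fin.toℕ<n (offset x))) ⟩
    toℕ (block x) + 0                               ≡⟨ +-identityʳ _ ⟩
    toℕ (block x)                                   ∎)
    where open ≡-Reasoning

  -- `φ` deletes the last base-`k` digit of `x` and puts the letter in front. For powers `P` and `Q`
  -- of `k`, the digits of `φ x` from `P` upwards are thus this letter followed by the digits of `x`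
  -- from `k * P` upwards.
  leading-digits : ∀ Q P .{{_ : NonZero P}} .{{_ : NonZero (k * P)}} → n ≡ Q * P → ∀ x →
    toℕ (φ x) / P ≡ Q * toℕ (letter σ x) + toℕ x / (k * P)
  leading-digits Q P n≡QP x = begin
    toℕ (φ x) / P                             ≡⟨ cong (_/ P) (toℕ-standard σ x) ⟩
    (n * a + toℕ (block x)) / P               ≡⟨ cong (λ z → (z + toℕ (block x)) / P) split ⟩
    (Q * a * P + toℕ (block x)) / P           ≡⟨ +-distrib-/-∣ˡ (toℕ (block x)) (n∣m*n (Q * a)) ⟩
    Q * a * P / P + toℕ (block x) / P         ≡⟨ cong₂ _+_ (m*n/n≡m (Q * a) P) (cong (_/ P) (toℕ-block x)) ⟩
    Q * a + toℕ x / k / P                     ≡⟨ cong (Q * a +_) (m/n/o≡m/[n*o] (toℕ x) k P) ⟩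
    Q * a + toℕ x / (k * P)                   ∎
    where
    open ≡-Reasoning
    a = toℕ (letter σ x)
    split : n * a ≡ Q * a * P
    split = begin
      n * a         ≡⟨ cong (_* a) n≡QP ⟩
      Q * P * a     ≡⟨ *-assoc Q P a ⟩
      Q * (P * a)   ≡⟨ cong (Q *_) (*-comm P a) ⟩
      Q * (a * P)   ≡⟨ *-assoc Q a P ⟨
      Q * a * P     ∎

  -- After j steps the leading j base-k digits of a position are the last j letters read.
  letters-determine-digits : ∀ {x y} j P .{{_ : NonZero P}} → k * n ≡ k ^ j * P →
    (∀ {i} → i < j → letter σ (fold x φ i) ≡ letter σ (fold y φ i)) →
    toℕ (fold x φ j) / P ≡ toℕ (fold y φ j) / P
  -- With no letter read, `P` equals `k * n` and both quotients vanish.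
  letters-determine-digits {x} {y} zero P kn≡P _ = trans (m<n⇒m/n≡0 (below x)) (sym (m<n⇒m/n≡0 (below y)))
    where
    below : ∀ x → toℕ x < P
    below x = <-≤-trans (Fin.toℕ<n x) (≤-reflexive (trans kn≡P (*-identityˡ P)))
  letters-determine-digits {x} {y} (suc j) P kn≡kQP same = begin
    toℕ (φ (fold x φ j)) / P
      ≡⟨ leading-digits (k ^ j) P n≡QP (fold x φ j) ⟩
    k ^ j * toℕ (letter σ (fold x φ j)) + toℕ (fold x φ j) / (k * P)
      ≡⟨ cong₂ (λ a z → k ^ j * toℕ a + z) (same ≤-refl)
           (letters-determine-digits j (k * P) kn≡QkP (same ∘ m<n⇒m<1+n)) ⟩
    k ^ j * toℕ (letter σ (fold y φ j)) + toℕ (fold y φ j) / (k * P)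
      ≡⟨ leading-digits (k ^ j) P n≡QP (fold y φ j) ⟨
    toℕ (φ (fold y φ j)) / P
      ∎
    where
    open ≡-Reasoning
    instance _ = m*n≢0 k P
    n≡QP : n ≡ k ^ j * P
    n≡QP = *-cancelˡ-≡ _ _ k (trans kn≡kQP (*-assoc k (k ^ j) P))
    kn≡QkP : k * n ≡ k ^ j * (k * P)
    kn≡QkP = begin
      k * n             ≡⟨ kn≡kQP ⟩
      k * k ^ j * P     ≡⟨ cong (_* P) (*-comm k (k ^ j)) ⟩
      k ^ j * k * P     ≡⟨ *-assoc (k ^ j) k P ⟩
      k ^ j * (k * P)   ∎

  -- After `m + 1` steps the divisor is down to `1`, so the two paths have met; injectivity of `φ`
  -- leads back to their starts.
  letters-determine : ∀ {x y} → (∀ {i} → i < suc m → letter σ (fold x φ i) ≡ letter σ (fold y φ i)) → x ≡ y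
  letters-determine {x} {y} same = fold-injective φ-injective (suc m) (Fin.toℕ-injective
    (trans (sym (n/1≡n _)) (trans (letters-determine-digits (suc m) 1 kn≡k^1+m same) (n/1≡n _))))
    where
    kn≡k^1+m : k * n ≡ k ^ suc m * 1
    kn≡k^1+m = trans (cong (k *_) n≡k^m) (sym (*-identityʳ _))

  module _ (x₀ : Fin (k * n)) where
    private
      L = k * n
      u = row x₀

    returns : ∀ c → fold x₀ φ (c * L) ≡ x₀
    returns c = fold-period c (period φ-injective transitive x₀)

    instance
      L≢0 : NonZero L
      L≢0 = Fin.nonZeroIndex x₀

    -- The letter at index `s` modulo `L` is read `s + 1` steps before the path returns to `x₀`; any
    -- `t` with `suc s + t` a multiple of `L` names that point.
    lookup-row : ∀ s t c → suc s + t ≡ c * L → ∀ (i : Fin (length u)) → toℕ i ≡ s % L →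
                 lookup u i ≡ letter σ (fold x₀ φ t)
    lookup-row s t c st≡cL i i≡s%L = trans (List.lookup-applyDownFrom (letter σ ∘ fold x₀ φ) L i)
      (cong (letter σ) (fold-injective φ-injective (suc s) (begin
        fold (fold x₀ φ (L ∸ suc (toℕ i))) φ (suc s)    ≡⟨ fold-+ x₀ φ (suc s) ⟨
        fold x₀ φ (suc s + (L ∸ suc (toℕ i)))           ≡⟨ cong (fold x₀ φ) whole ⟩
        fold x₀ φ (suc (s / L) * L)                     ≡⟨ returns (suc (s / L)) ⟩
        x₀                                              ≡⟨ returns c ⟨
        fold x₀ φ (c * L)                               ≡⟨ cong (fold x₀ φ) st≡cL ⟨
        fold x₀ φ (suc s + t)                           ≡⟨ fold-+ x₀ φ (suc s) ⟩
        fold (fold x₀ φ t) φ (suc s)                    ∎)))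
      where
      open ≡-Reasoning
      whole : suc s + (L ∸ suc (toℕ i)) ≡ suc (s / L) * L
      whole = begin
        suc s + (L ∸ suc (toℕ i))                         ≡⟨ cong₂ (λ s r → suc s + (L ∸ suc r)) (m≡m%n+[m/n]*n s L) i≡s%L ⟩
        suc (s % L + s / L * L) + (L ∸ suc (s % L))       ≡⟨ cong (λ z → suc z + (L ∸ suc (s % L))) (+-comm (s % L) (s / L * L)) ⟩
        suc (s / L * L + s % L) + (L ∸ suc (s % L))       ≡⟨ cong (_+ (L ∸ suc (s % L))) (+-suc (s / L * L) (s % L)) ⟨
        s / L * L + suc (s % L) + (L ∸ suc (s % L))       ≡⟨ +-assoc (s / L * L) (suc (s % L)) _ ⟩
        s / L * L + (suc (s % L) + (L ∸ suc (s % L)))     ≡⟨ cong (s / L * L +_) (m+[n∸m]≡n (m%n<n s L)) ⟩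
        s / L * L + L                                     ≡⟨ +-comm (s / L * L) L ⟩
        suc (s / L) * L                                   ∎

    -- As `φ` has period `L`, going `c * pred L` steps forward amounts to going `c` steps back.
    c+c*pred[L]≡c*L : ∀ c → c + c * pred L ≡ c * L
    c+c*pred[L]≡c*L c = trans (sym (*-suc c (pred L))) (cong (c *_) (suc-pred L))

    -- The circular factor of length d = m + 1 at i consists of the letters met
    -- on the φ-path from window i to φ^d (window i), read backwards.
    window : Fin (length u) → Fin L
    window i = fold x₀ φ ((toℕ i + suc m) * pred L)

    window-path : ∀ i → fold (window i) φ (toℕ i + suc m) ≡ x₀
    window-path i = begin
      fold (window i) φ c          ≡⟨ fold-+ x₀ φ c ⟨
      fold x₀ φ (c + c * pred L)   ≡⟨ cong (fold x₀ φ) (c+c*pred[L]≡c*L c) ⟩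
      fold x₀ φ (c * L)            ≡⟨ returns c ⟩
      x₀                           ∎
      where
      open ≡-Reasoning
      c = toℕ i + suc m

    letterAfter-window : ∀ i {j t} → j + t ≡ m → letterAfter u i j ≡ letter σ (fold (window i) φ t)
    letterAfter-window i {j} {t} refl = trans
      (lookup-row (toℕ i + j) (t + c * pred L) c (begin
        suc (toℕ i + j) + (t + c * pred L)    ≡⟨ +-assoc (suc (toℕ i + j)) t _ ⟨
        suc (toℕ i + j + t) + c * pred L      ≡⟨ cong (λ z → suc z + c * pred L) (+-assoc (toℕ i) j t) ⟩
        suc (toℕ i + (j + t)) + c * pred L    ≡⟨ cong (_+ c * pred L) (+-suc (toℕ i) (j + t)) ⟨
        c + c * pred L                        ≡⟨ c+c*pred[L]≡c*L c ⟩
        c * L                                 ∎)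
        _ (trans (Fin.toℕ-fromℕ< _) (%-congʳ (length-row x₀))))
      (cong (letter σ) (fold-+ x₀ φ t))
      where
      open ≡-Reasoning
      c = toℕ i + suc m
      instance _ = Fin.nonZeroIndex i

    -- From the common window, `i + m + 1` and `i′ + m + 1` steps both end at `x₀`. Cancelling
    -- `m + 1` of them leaves two exponents below `L` with the same iterate, and such iterates are
    -- distinct for distinct exponents.
    window-injective : ∀ {i i′} → window i ≡ window i′ → i ≡ i′
    window-injective {i} {i′} eq = Fin.toℕ-injective (begin
      toℕ i                          ≡⟨ Fin.toℕ-cast len i ⟨
      toℕ (cast len i)               ≡⟨ cong toℕ (fold-toℕ-injective φ-injective transitive (window i) same-point) ⟩
      toℕ (cast len i′)              ≡⟨ Fin.toℕ-cast len i′ ⟩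
      toℕ i′                         ∎)
      where
      open ≡-Reasoning
      len = length-row x₀
      same-point : fold (window i) φ (toℕ (cast len i)) ≡ fold (window i) φ (toℕ (cast len i′))
      same-point = fold-injective φ-injective (suc m) (begin
        fold (fold (window i) φ (toℕ (cast len i))) φ (suc m)     ≡⟨ shifted i i refl ⟩
        x₀                                                        ≡⟨ shifted i i′ eq ⟨
        fold (fold (window i) φ (toℕ (cast len i′))) φ (suc m)    ∎)
        where
        shifted : ∀ i i′ → window i ≡ window i′ →
                  fold (fold (window i) φ (toℕ (cast len i′))) φ (suc m) ≡ x₀
        shifted i i′ eq = begin
          fold (fold (window i) φ (toℕ (cast len i′))) φ (suc m)    ≡⟨ cong₂ (λ z t → fold (fold z φ t) φ (suc m)) eq (Fin.toℕ-cast len i′) ⟩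
          fold (fold (window i′) φ (toℕ i′)) φ (suc m)              ≡⟨ fold-+ (window i′) φ (suc m) ⟨
          fold (window i′) φ (suc m + toℕ i′)                       ≡⟨ cong (fold (window i′) φ) (+-comm (suc m) (toℕ i′)) ⟩
          fold (window i′) φ (toℕ i′ + suc m)                       ≡⟨ window-path i′ ⟩
          x₀                                                        ∎

    -- Letter `m - t` of the factor is met `t` steps along the window's path, so equal factors give
    -- equal letters on both paths, and these fix the window.
    letterAfter-injective : ∀ {i i′} →
      (∀ (j : Fin (suc m)) → letterAfter u i (toℕ j) ≡ letterAfter u i′ (toℕ j)) → i ≡ i′
    letterAfter-injective {i} {i′} same = window-injective (letters-determine λ {t} t<d →
      trans (sym (letterAfter-window i (back t t<d)))
        (trans (same (fromℕ< (s≤s (m∸n≤m m t)))) (letterAfter-window i′ (back t t<d))))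
      where
      back : ∀ t → t < suc m → toℕ (fromℕ< (s≤s (m∸n≤m m t))) + t ≡ m
      back t t<d = trans (cong (_+ t) (Fin.toℕ-fromℕ< _)) (m∸n+n≡m (s≤s⁻¹ t<d))

    word : Fin (length u) → Fin (k ^ suc m)
    word i = funToFin (λ (j : Fin (suc m)) → letterAfter u i (toℕ j))

    word-injective : Injective _≡_ _≡_ word
    word-injective eq = letterAfter-injective (funToFin-injective eq)

    -- Distinct places carry distinct factors, and there are as many places as words of length
    -- `m + 1`, so counting yields an occurrence of each.
    row-isDeBruijn : IsDeBruijn (suc m) u
    row-isDeBruijn v = unique (injective⇒surjective enough word-injective (funToFin (Vec.lookup v)))
      where
      enough : k ^ suc m ≤ length u
      enough = ≤-reflexive (sym (trans (length-row x₀) (cong (k *_) n≡k^m)))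

      unique : ∃[ i ] word i ≡ funToFin (Vec.lookup v) → ∃! _≡_ (OccursCircularlyAt v u)
      unique (i , eq) = i , occurs , λ occurs′ → letterAfter-injective λ j → trans (occurs j) (sym (occurs′ j))
        where
        occurs : OccursCircularlyAt v u i
        occurs = funToFin-injective eq

-- One word for both existence claims.

unclustered-row : ∀ {n k} → n > 0 → k ≥ 3 → ∃[ u ] (length u ≡ k * n × CompletelyUnclusteredBWT {k} u ×
  IsGeneralizedDeBruijn n u × (∀ m → n ≡ k ^ m → IsDeBruijn (suc m) u))
unclustered-row {suc n} {suc (suc (suc k))} _ (s≤s (s≤s (s≤s _))) = properties
  -- `k ≥ 3` supplies the three distinct offsets; with `3 + k` letters after matching, the last
  -- offset of a block is `2 + k`.
  (unclustered-cycle {r₀ = 0F} {1F} {2F} (λ ()) (λ ()) (λ ()) (s≤s (s≤s z≤n)) {zero} {zero} refl refl (fromℕ (2 + k)))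
  where
  K = 3 + k
  properties : ∃[ σ ] Transitive (Standard.standard (suc n) K σ) × Unclustered 0F (fromℕ (2 + k)) σ (suc n) →
    ∃[ u ] (length u ≡ K * suc n × CompletelyUnclusteredBWT {K} u ×
      IsGeneralizedDeBruijn (suc n) u × (∀ m → suc n ≡ K ^ m → IsDeBruijn (suc m) u))
  properties (σ , transitive , unclustered) =
    Inversion.row σ transitive zero , Inversion.length-row σ transitive zero ,
    row-completelyUnclustered σ transitive unclustered zero ,
    row-isGeneralizedDeBruijn σ transitive zero ,
    λ m n≡k^m → row-isDeBruijn n≡k^m σ transitive zero

theorem12 : (∀ (n k : ℕ) → n > 0 → k ≥ 3 →
    ∃[ u ] (IsGeneralizedDeBruijn n {k} u × CompletelyUnclusteredBWT u))
    ×
    (∀ (n k : ℕ) → n > 0 → k ≥ 3 →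
    ∃[ u ] (IsDeBruijn n {k} u × length u ≡ k ^ n × CompletelyUnclusteredBWT u))
theorem12 =
  (λ n k n>0 k≥3 → let u , _ , unclustered , generalized , _ = unclustered-row n>0 k≥3 in
    u , generalized , unclustered) ,
  -- Order `m + 1` means length `k * k ^ m`, hence `k ^ m` blocks.
  λ { (suc m) k _ k≥3 →
    let u , len , unclustered , _ , deBruijn =
          unclustered-row {k ^ m} {k} (m^n>0 k {{>-nonZero (≤-trans (s≤s z≤n) k≥3)}} m) k≥3 in
    u , deBruijn m refl , len , unclustered }
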